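{- There is an absolute constant $C>0$ such that the following holds. Let $k,n$ be integers larger than $1$, and let $W$ be the width of $[k]^n$. If $\mathcal{F}\subset[k]^n$ does not contain three distinct elements $\mathbf u,\mathbf v,\mathbf w$ with $\mathbf u=\mathbf v\vee\mathbf w$, then $|\mathcal{F}|\le C\,W$.
   Context: $[k]^n$ denotes the set of vectors with entries in $\{1,\dots,k\}$, ordered coordinatewise; its width is the size of a largest antichain. For $\mathbf v,\mathbf w\in[k]^n$, $\mathbf v\vee\mathbf w=(\max\{\mathbf v(1),\mathbf w(1)\},\dots,\max\{\mathbf v(n),\mathbf w(n)\})$. -}

module Defs where

open import Data.Nat using (ℕ; _≤ᵇ_)
open import Data.Bool using (if_then_else_)
open import Data.Fin using (Fin; toℕ) renaming (_≤_ to _≤F_)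
open import Data.Vec using (Vec; lookup; zipWith)
open import Data.List using (List; length)
open import Data.List.Membership.Propositional using (_∈_)
open import Data.List.Relation.Unary.Unique.Propositional using (Unique)
open import Data.Product using (Σ; _×_; ∃)
open import Relation.Binary.PropositionalEquality using (_≡_; _≢_)
open import Relation.Nullary using (¬_)

-- The grid [k]^n, with [k] = {1,…,k} represented by Fin k = {0,…,k-1}
-- (an order isomorphism).
Grid : ℕ → ℕ → Set
Grid k n = Vec (Fin k) n

_≼_ : ∀ {k n} → Grid k n → Grid k n → Set
v ≼ w = ∀ i → lookup v i ≤F lookup w i

maxF : ∀ {k} → Fin k → Fin k → Fin k
maxF a b = if toℕ a ≤ᵇ toℕ b then b else a

_∨_ : ∀ {k n} → Grid k n → Grid k n → Grid k n
v ∨ w = zipWith maxF v w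

-- A finite subset of [k]^n: a duplicate-free list; its size is its length.
-- An antichain: a finite subset in which no two distinct elements are comparable.
IsAntichain : ∀ {k n} → List (Grid k n) → Set
IsAntichain A = Unique A × (∀ x y → x ∈ A → y ∈ A → x ≼ y → x ≡ y)

IsWidth : ℕ → ℕ → ℕ → Set
IsWidth k n W =
  (Σ (List (Grid k n)) λ A → IsAntichain A × length A ≡ W)
  × (∀ (A : List (Grid k n)) → IsAntichain A → length A Data.Nat.≤ W)

VeeFree : ∀ {k n} → List (Grid k n) → Set
VeeFree {k} {n} F =
  ¬ (Σ (Grid k n) λ u → Σ (Grid k n) λ v → Σ (Grid k n) λ w →
       u ∈ F × v ∈ F × w ∈ F × u ≢ v × u ≢ w × v ≢ w × u ≡ v ∨ w)

{-# OPTIONS --safe #-}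
-- Write [k]^n = [k]^e × [k]^p × [k]^p with e ≤ 1.  If (z,x,y) ∈ F lies above some
-- (z,x′,y) ∈ F and above some (z,x,y′) ∈ F, it is the join of these two; hence each
-- element of F is minimal in its x-fibre or in its y-fibre.  Minimal elements form
-- antichains, so by Sperner's theorem for [k]^p (a symmetric chain decomposition)
-- |F| ≤ 2 k^(e+p) L_p(m), where L_p(s) counts the elements of rank s and m is the
-- middle rank.
--
-- L_p is log-concave, so L_p(m) L_p(t) ≤ L_p(⌊(m+t)/2⌋) L_p(⌈(m+t)/2⌉).  Summing over t,
-- L_p(m) k^p ≤ Σ_s L_p(s)² + Σ_s L_p(s) L_p(s+1), and by the symmetry of L_p the two sums
-- are sizes of levels, hence of antichains, of [k]^(2p).  When e = 1, some level of
-- [k]^(2p+1) is at least k/3 times as large as a given level of [k]^(2p), since p ≥ 1.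
module Submission where

open import Defs
open import Data.Bool using (Bool; true; false; T; if_then_else_)
open import Data.Empty using (⊥; ⊥-elim)
open import Data.Fin using (Fin; zero; suc; toℕ; fromℕ<) renaming (_≟_ to _≟F_; _≤?_ to _≤F?_)
open import Data.Fin.Permutation using (reverse)
open import Data.Fin.Properties
  using (toℕ<n; toℕ≤pred[n]; toℕ-fromℕ<; toℕ-injective; injective⇒≤; opposite-prop; all?)
open import Data.List using (List; []; _∷_; length; filter; map; tabulate; allFin; cartesianProductWith; cartesianProduct)
import Data.List as List
open import Data.List.Membership.Propositional using (_∈_; find; lose)
open import Data.List.Membership.Propositional.Properties
  using (∈-lookup; ∈-filter⁺; ∈-filter⁻; ∈-cartesianProductWith⁺; ∈-cartesianProduct⁺; ∈-allFin)
open import Data.List.Membership.Setoid.Properties using (index-injective)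
open import Data.List.Properties using (length-map; length-++; length-tabulate; filter-++)
open import Data.List.Relation.Unary.All as All using (All)
open import Data.List.Relation.Unary.AllPairs using ([]; _∷_)
open import Data.List.Relation.Unary.Any as Any using (Any; here; there; index)
open import Data.List.Relation.Unary.Unique.Propositional using (Unique)
import Data.List.Relation.Unary.Unique.Propositional.Properties as Unique
open import Data.Nat
  using (ℕ; zero; suc; _+_; _*_; _∸_; _^_; _⊓_; _≤_; _<_; _≤ᵇ_; _≟_; _≤?_; _<?_; z≤n; s≤s; ⌊_/2⌋; ⌈_/2⌉)
open import Data.Nat.Properties
open import Data.Nat.Tactic.RingSolver using (solve-∀)
open import Data.Product using (Σ; _×_; _,_; proj₁; proj₂)
open import Data.Product.Properties using (,-injective; ,-injectiveʳ)
open import Data.Sum using (_⊎_; inj₁; inj₂)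
open import Data.Vec using ([]; _∷_; lookup; take; drop; _++_)
open import Data.Vec.Properties
  using (++-injectiveˡ; ++-injectiveʳ; ∷-injective; ≡-dec; take++drop≡id; zipWith-++)
open import Relation.Binary.PropositionalEquality
  using (_≡_; _≢_; refl; sym; trans; cong; cong₂; subst; subst₂; setoid)
open import Relation.Nullary using (¬_; Dec; yes; no; does; ¬?; contradiction)
open import Relation.Nullary.Decidable using (_×-dec_)

open import Algebra.Properties.Semiring.Sum +-*-semiring
  using (sum; sum-cong-≗; ∑-distrib-+; ∑-comm; ∑-permute; *-distribˡ-sum; *-distribʳ-sum)

open ≤-Reasoning

-- Finite sums over initial segments of the naturals.

∑ : ℕ → (ℕ → ℕ) → ℕ
∑ n f = sum {n} (λ i → f (toℕ i))

∑-cong : ∀ n {f g} → (∀ i → i < n → f i ≡ g i) → ∑ n f ≡ ∑ n g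
∑-cong n f≡g = sum-cong-≗ {n} (λ i → f≡g (toℕ i) (toℕ<n i))

∑-mono : ∀ n {f g} → (∀ i → i < n → f i ≤ g i) → ∑ n f ≤ ∑ n g
∑-mono zero    f≤g = z≤n
∑-mono (suc n) f≤g = +-mono-≤ (f≤g 0 (s≤s z≤n)) (∑-mono n (λ i i<n → f≤g (suc i) (s≤s i<n)))

∑-const : ∀ n c → ∑ n (λ _ → c) ≡ n * c
∑-const zero    c = refl
∑-const (suc n) c = cong (c +_) (∑-const n c)

∑-+ : ∀ n f g → ∑ n (λ i → f i + g i) ≡ ∑ n f + ∑ n g
∑-+ n f g = ∑-distrib-+ {n} (λ i → f (toℕ i)) (λ i → g (toℕ i))

∑-*ˡ : ∀ n c f → c * ∑ n f ≡ ∑ n (λ i → c * f i)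
∑-*ˡ n c f = *-distribˡ-sum {n} c (λ i → f (toℕ i))

∑-*ʳ : ∀ n c f → ∑ n f * c ≡ ∑ n (λ i → f i * c)
∑-*ʳ n c f = *-distribʳ-sum {n} c (λ i → f (toℕ i))

∑-swap : ∀ m n (f : ℕ → ℕ → ℕ) → ∑ m (λ i → ∑ n (λ j → f i j)) ≡ ∑ n (λ j → ∑ m (λ i → f i j))
∑-swap m n f = ∑-comm {m} {n} (λ i j → f (toℕ i) (toℕ j))

∑-split : ∀ m n f → ∑ (m + n) f ≡ ∑ m f + ∑ n (λ i → f (m + i))
∑-split zero    n f = refl
∑-split (suc m) n f = trans (cong (f 0 +_) (∑-split m n (λ i → f (suc i)))) (sym (+-assoc (f 0) _ _))

∑-mono-range : ∀ {m n} f → m ≤ n → ∑ m f ≤ ∑ n f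
∑-mono-range {m} {n} f m≤n = begin
  ∑ m f                                        ≤⟨ m≤m+n _ _ ⟩
  ∑ m f + ∑ (n ∸ m) (λ i → f (m + i))          ≡⟨ ∑-split m (n ∸ m) f ⟨
  ∑ (m + (n ∸ m)) f                            ≡⟨ cong (λ l → ∑ l f) (m+[n∸m]≡n m≤n) ⟩
  ∑ n f                                        ∎

∑-reverse : ∀ d f → ∑ (suc d) f ≡ ∑ (suc d) (λ j → f (d ∸ j))
∑-reverse d f = trans (∑-permute {suc d} (λ i → f (toℕ i)) reverse)
  (sum-cong-≗ {suc d} (λ i → cong f (opposite-prop i)))

∑-product : ∀ n f g → ∑ n f * ∑ n g ≡ ∑ n (λ i → ∑ n (λ j → f i * g j))
∑-product n f g = trans (∑-*ʳ n (∑ n g) f) (∑-cong n (λ i _ → ∑-*ˡ n (f i) g))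

-- Both double sums are invariant under exchanging i and j, so twice each of
-- them is a sum of symmetrised terms.
∑∑-mono-symmetrised : ∀ n (φ ψ : ℕ → ℕ → ℕ) →
  (∀ i j → i ≤ j → φ i j + φ j i ≤ ψ i j + ψ j i) →
  ∑ n (λ i → ∑ n (λ j → φ i j)) ≤ ∑ n (λ i → ∑ n (λ j → ψ i j))
∑∑-mono-symmetrised n φ ψ h = *-cancelˡ-≤ 2 (subst₂ _≤_ (twice φ) (twice ψ)
    (∑-mono n (λ i _ → ∑-mono n (λ j _ → any i j))))
  where
  any : ∀ i j → φ i j + φ j i ≤ ψ i j + ψ j i
  any i j with ≤-total i j
  ... | inj₁ i≤j = h i j i≤j
  ... | inj₂ j≤i = subst₂ _≤_ (+-comm (φ j i) _) (+-comm (ψ j i) _) (h j i j≤i)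

  twice : ∀ χ → ∑ n (λ i → ∑ n (λ j → χ i j + χ j i)) ≡ 2 * ∑ n (λ i → ∑ n (λ j → χ i j))
  twice χ = begin-equality
    ∑ n (λ i → ∑ n (λ j → χ i j + χ j i))
      ≡⟨ ∑-cong n (λ i _ → ∑-+ n (χ i) (λ j → χ j i)) ⟩
    ∑ n (λ i → ∑ n (χ i) + ∑ n (λ j → χ j i))
      ≡⟨ ∑-+ n (λ i → ∑ n (χ i)) (λ i → ∑ n (λ j → χ j i)) ⟩
    S + ∑ n (λ i → ∑ n (λ j → χ j i))
      ≡⟨ cong (S +_) (∑-swap n n (λ i j → χ j i)) ⟩
    S + S
      ≡⟨ cong (S +_) (+-identityʳ S) ⟨
    2 * S ∎
    where S = ∑ n (λ i → ∑ n (χ i))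

-- The two sides differ by `(a ∸ b) * (p ∸ q)`.
rearrangement : ∀ {a b p q} → b ≤ a → q ≤ p → a * q + b * p ≤ a * p + b * q
rearrangement {a} {b} {p} {q} b≤a q≤p =
  subst₂ (λ a p → a * q + b * p ≤ a * p + b * q) (m+[n∸m]≡n b≤a) (m+[n∸m]≡n q≤p)
    (subst (λ r → (b + x) * q + b * (q + y) ≤ r) (sym (expand b x q y)) (m≤m+n _ _))
  where
  x = a ∸ b
  y = p ∸ q
  expand : ∀ b x q y → (b + x) * (q + y) + b * q ≡ ((b + x) * q + b * (q + y)) + x * y
  expand = solve-∀

-- Indicators of decidable propositions.

𝟙 : ∀ {P : Set} → Dec P → ℕ
𝟙 P? = if does P? then 1 else 0

𝟙-mono : ∀ {P Q : Set} (P? : Dec P) (Q? : Dec Q) → (P → Q) → 𝟙 P? ≤ 𝟙 Q?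
𝟙-mono (no _)  _       _   = z≤n
𝟙-mono (yes p) (yes _) _   = ≤-refl
𝟙-mono (yes p) (no ¬q) p⇒q = contradiction (p⇒q p) ¬q

𝟙-cong : ∀ {P Q : Set} (P? : Dec P) (Q? : Dec Q) → (P → Q) → (Q → P) → 𝟙 P? ≡ 𝟙 Q?
𝟙-cong P? Q? f g = ≤-antisym (𝟙-mono P? Q? f) (𝟙-mono Q? P? g)

𝟙-yes : ∀ {P : Set} (P? : Dec P) → P → 𝟙 P? ≡ 1
𝟙-yes (yes _) _ = refl
𝟙-yes (no ¬p) p = contradiction p ¬p

𝟙-no : ∀ {P : Set} (P? : Dec P) → ¬ P → 𝟙 P? ≡ 0
𝟙-no (yes p) ¬p = contradiction p ¬p
𝟙-no (no _)  _  = refl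

𝟙*𝟙-mono : ∀ {P Q R S : Set} (P? : Dec P) (Q? : Dec Q) (R? : Dec R) (S? : Dec S) →
  (P → Q → R × S) → 𝟙 P? * 𝟙 Q? ≤ 𝟙 R? * 𝟙 S?
𝟙*𝟙-mono (no _)  _       _  _  _ = z≤n
𝟙*𝟙-mono (yes _) (no _)  _  _  _ = z≤n
𝟙*𝟙-mono (yes p) (yes q) R? S? f
  rewrite 𝟙-yes R? (proj₁ (f p q)) | 𝟙-yes S? (proj₂ (f p q)) = ≤-refl

𝟙≤𝟙+𝟙 : ∀ {P Q R : Set} (P? : Dec P) (Q? : Dec Q) (R? : Dec R) →
  (P → Q ⊎ R) → 𝟙 P? ≤ 𝟙 Q? + 𝟙 R?
𝟙≤𝟙+𝟙 (no _)  _  _  _ = z≤n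
𝟙≤𝟙+𝟙 (yes p) Q? R? f with f p
... | inj₁ q rewrite 𝟙-yes Q? q = s≤s z≤n
... | inj₂ r rewrite 𝟙-yes R? r = m≤n+m 1 (𝟙 Q?)

-- Only the term `b = a` can survive; equality fails when `a` lies outside the range and `φ a` is
-- positive.
∑-𝟙≟ : ∀ n a φ → ∑ n (λ b → 𝟙 (a ≟ b) * φ b) ≤ φ a
∑-𝟙≟ zero    a       φ = z≤n
∑-𝟙≟ (suc n) zero    φ = ≤-reflexive (begin-equality
  (φ 0 + 0) + ∑ n (λ b → 𝟙 (0 ≟ suc b) * φ (suc b))
    ≡⟨ cong₂ _+_ (+-identityʳ (φ 0)) (trans (∑-const n 0) (*-zeroʳ n)) ⟩
  φ 0 + 0
    ≡⟨ +-identityʳ (φ 0) ⟩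
  φ 0 ∎)
∑-𝟙≟ (suc n) (suc a) φ = ≤-trans
  (≤-reflexive (∑-cong n (λ b _ → cong (_* φ (suc b)) (𝟙-cong (suc a ≟ suc b) (a ≟ b) suc-injective (cong suc)))))
  (∑-𝟙≟ n a (λ b → φ (suc b)))

-- Intervals of length `k` as indicators.

module Window (k : ℕ) where

  inWindow? : ∀ a b → Dec (a ≤ b × b < a + k)
  inWindow? a b = a ≤? b ×-dec b <? a + k

  -- Moves the dependence on `a` from the range into a weight, so that sums over different windows
  -- can be compared term by term over one common range.
  window : ∀ {n} a (φ : ℕ → ℕ) → a + k ≤ n → ∑ k (λ j → φ (a + j)) ≡ ∑ n (λ b → 𝟙 (inWindow? a b) * φ b)
  window {n} a φ a+k≤n = sym (begin-equality
    ∑ n g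
      ≡⟨ cong (λ l → ∑ l g) (sym (trans (sym (+-assoc a k r)) (m+[n∸m]≡n a+k≤n))) ⟩
    ∑ (a + (k + r)) g
      ≡⟨ ∑-split a (k + r) g ⟩
    ∑ a g + ∑ (k + r) (λ i → g (a + i))
      ≡⟨ cong₂ _+_ before (∑-split k r (λ i → g (a + i))) ⟩
    ∑ k (λ i → g (a + i)) + ∑ r (λ i → g (a + (k + i)))
      ≡⟨ cong₂ _+_ inside after ⟩
    ∑ k (λ j → φ (a + j)) + 0
      ≡⟨ +-identityʳ _ ⟩
    ∑ k (λ j → φ (a + j)) ∎)
    where
    r = n ∸ (a + k)
    g : ℕ → ℕ
    g b = 𝟙 (inWindow? a b) * φ b

    ∑≡0 : ∀ m {h} → (∀ i → i < m → h i ≡ 0) → ∑ m h ≡ 0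
    ∑≡0 m h≡0 = trans (∑-cong m h≡0) (trans (∑-const m 0) (*-zeroʳ m))

    before : ∑ a g ≡ 0
    before = ∑≡0 a (λ i i<a → cong (_* φ i) (𝟙-no (inWindow? a i) (λ in-w → <⇒≱ i<a (proj₁ in-w))))

    after : ∑ r (λ i → g (a + (k + i))) ≡ 0
    after = ∑≡0 r (λ i _ → cong (_* φ (a + (k + i)))
      (𝟙-no (inWindow? a (a + (k + i))) (λ in-w → <⇒≱ (proj₂ in-w) (+-monoʳ-≤ a (m≤m+n k i)))))

    inside : ∑ k (λ i → g (a + i)) ≡ ∑ k (λ j → φ (a + j))
    inside = ∑-cong k (λ i i<k → trans
      (cong (_* φ (a + i)) (𝟙-yes (inWindow? a (a + i)) (m≤m+n a i , +-monoʳ-< a i<k)))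
      (+-identityʳ _))

  -- If the later window contains the smaller point and the earlier window the larger one, then both
  -- points lie in both windows.
  window-TP2 : ∀ {a a′ i j} → a ≤ a′ → i ≤ j →
    𝟙 (inWindow? a j) * 𝟙 (inWindow? a′ i) ≤ 𝟙 (inWindow? a i) * 𝟙 (inWindow? a′ j)
  window-TP2 {a} {a′} {i} {j} a≤a′ i≤j =
    𝟙*𝟙-mono (inWindow? a j) (inWindow? a′ i) (inWindow? a i) (inWindow? a′ j)
      (λ (_ , j<) (a′≤i , _) →
        (≤-trans a≤a′ a′≤i , ≤-<-trans i≤j j<) ,
        (≤-trans a′≤i i≤j , <-≤-trans j< (+-monoˡ-≤ k a≤a′)))

-- Level sizes as a totally positive kernel.

module Count (d : ℕ) where

  k : ℕ
  k = suc d

  open Window k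

  -- G p a c is the number of x ∈ [k]^p with a + rank x ≡ c; in this form it is a
  -- totally positive kernel, and shifting the rank needs no subtraction.
  G : ℕ → ℕ → ℕ → ℕ
  G zero    a c = 𝟙 (a ≟ c)
  G (suc p) a c = ∑ k (λ j → G p (a + j) c)

  G-translate : ∀ p t a c → G p (t + a) (t + c) ≡ G p a c
  G-translate zero    t a c = 𝟙-cong (t + a ≟ t + c) (a ≟ c) (+-cancelˡ-≡ t a c) (cong (t +_))
  G-translate (suc p) t a c = ∑-cong k (λ j _ →
    trans (cong (λ b → G p b (t + c)) (+-assoc t a j)) (G-translate p t (a + j) c))

  -- Complementing every coordinate, `j` to `d ∸ j`, turns rank `r` into `p * d ∸ r`. In the
  -- induction this reverses the sum over `j` and translates by `d ∸ j`.
  G-symmetric : ∀ p a c → G p a c ≡ G p c (a + p * d)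
  G-symmetric zero a c = 𝟙-cong (a ≟ c) (c ≟ a + 0)
    (λ a≡c → trans (sym a≡c) (sym (+-identityʳ a))) (λ c≡a → trans (sym (+-identityʳ a)) (sym c≡a))
  G-symmetric (suc p) a c = begin-equality
    ∑ k (λ j → G p (a + j) c)
      ≡⟨ ∑-cong k (λ j _ → G-symmetric p (a + j) c) ⟩
    ∑ k (λ j → G p c (a + j + p * d))
      ≡⟨ ∑-cong k (λ { j (s≤s j≤d) → sym (shift j j≤d) }) ⟩
    ∑ k (λ j → G p (c + (d ∸ j)) (a + (d + p * d)))
      ≡⟨ ∑-reverse d (λ j → G p (c + j) (a + (d + p * d))) ⟨
    ∑ k (λ j → G p (c + j) (a + (d + p * d))) ∎
    where
    regroup : ∀ a x j y → a + ((x + j) + y) ≡ x + (a + j + y)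
    regroup = solve-∀
    shift : ∀ j → j ≤ d → G p (c + (d ∸ j)) (a + (d + p * d)) ≡ G p c (a + j + p * d)
    shift j j≤d = begin-equality
      G p (c + (d ∸ j)) (a + (d + p * d))
        ≡⟨ cong₂ (G p) (+-comm c (d ∸ j)) (cong (λ e → a + (e + p * d)) (sym (m∸n+n≡m j≤d))) ⟩
      G p ((d ∸ j) + c) (a + ((d ∸ j) + j + p * d))
        ≡⟨ cong (G p ((d ∸ j) + c)) (regroup a (d ∸ j) j (p * d)) ⟩
      G p ((d ∸ j) + c) ((d ∸ j) + (a + j + p * d))
        ≡⟨ G-translate p (d ∸ j) c _ ⟩
      G p c (a + j + p * d) ∎

  -- Nonnegativity of the two-by-two minors. `G (suc p)` is the product of the window kernel with
  -- `G p`, and this property passes to products of kernels as in the Cauchy-Binet formula.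
  G-TP2 : ∀ p {a a′ c c′} → a ≤ a′ → c ≤ c′ → G p a c′ * G p a′ c ≤ G p a c * G p a′ c′
  G-TP2 zero {a} {a′} {c} {c′} a≤a′ c≤c′ = 𝟙*𝟙-mono (a ≟ c′) (a′ ≟ c) (a ≟ c) (a′ ≟ c′)
    λ { refl refl → ≤-antisym a≤a′ c≤c′ , ≤-antisym c≤c′ a≤a′ }
  G-TP2 (suc p) {a} {a′} {c} {c′} a≤a′ c≤c′ =
    subst₂ _≤_ (sym (expand c′ c)) (sym (expand c c′)) (∑∑-mono-symmetrised n
      (λ i j → (u a i * G p i c′) * (u a′ j * G p j c)) (λ i j → (u a i * G p i c) * (u a′ j * G p j c′))
      exchange)
    where
    -- A range containing both windows.
    n = a′ + k
    u = λ a b → 𝟙 (inWindow? a b)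

    expand : ∀ c c′ → G (suc p) a c * G (suc p) a′ c′ ≡
      ∑ n (λ i → ∑ n (λ j → (u a i * G p i c) * (u a′ j * G p j c′)))
    expand c c′ = trans
      (cong₂ _*_ (window a (λ b → G p b c) (+-monoˡ-≤ k a≤a′)) (window a′ (λ b → G p b c′) ≤-refl))
      (∑-product n (λ i → u a i * G p i c) (λ j → u a′ j * G p j c′))

    regroup : ∀ u₁ u₂ u₃ u₄ g₁ g₂ g₃ g₄ →
      (u₁ * g₁) * (u₂ * g₂) + (u₃ * g₃) * (u₄ * g₄) ≡ (u₁ * u₂) * (g₁ * g₂) + (u₃ * u₄) * (g₄ * g₃)
    regroup = solve-∀

    -- The difference of the two sides is a minor of the window kernel times a minor of `G p`.
    exchange : ∀ i j → i ≤ j →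
      (u a i * G p i c′) * (u a′ j * G p j c) + (u a j * G p j c′) * (u a′ i * G p i c) ≤
      (u a i * G p i c) * (u a′ j * G p j c′) + (u a j * G p j c) * (u a′ i * G p i c′)
    exchange i j i≤j = subst₂ _≤_
      (sym (regroup (u a i) (u a′ j) (u a j) (u a′ i) (G p i c′) (G p j c) (G p j c′) (G p i c)))
      (sym (regroup (u a i) (u a′ j) (u a j) (u a′ i) (G p i c) (G p j c′) (G p j c) (G p i c′)))
      (rearrangement (window-TP2 a≤a′ i≤j) (G-TP2 p i≤j c≤c′))

  -- Cuts a vector after its first `p` coordinates, with `b` the offset reached there. Cuts with `b`
  -- at least `n` are missed, hence only an inequality.
  G-compose : ∀ p q n a c → ∑ n (λ b → G p a b * G q b c) ≤ G (p + q) a c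
  G-compose zero    q n a c = ∑-𝟙≟ n a (λ b → G q b c)
  G-compose (suc p) q n a c = begin
    ∑ n (λ b → ∑ k (λ j → G p (a + j) b) * G q b c)
      ≡⟨ ∑-cong n (λ b _ → ∑-*ʳ k (G q b c) (λ j → G p (a + j) b)) ⟩
    ∑ n (λ b → ∑ k (λ j → G p (a + j) b * G q b c))
      ≡⟨ ∑-swap n k (λ b j → G p (a + j) b * G q b c) ⟩
    ∑ k (λ j → ∑ n (λ b → G p (a + j) b * G q b c))
      ≤⟨ ∑-mono k (λ j _ → G-compose p q n (a + j) c) ⟩
    ∑ k (λ j → G (p + q) (a + j) c) ∎

  -- No rank exceeds `p * d`, so every vector is counted at some `c < n`.
  G-total : ∀ p {n} a → a + p * d < n → k ^ p ≤ ∑ n (G p a)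
  G-total zero    {suc n} zero    _         = s≤s z≤n
  G-total zero    {suc n} (suc a) (s≤s a<n) = ≤-trans (G-total zero a a<n)
    (≤-reflexive (∑-cong n (λ b _ → 𝟙-cong (a ≟ b) (suc a ≟ suc b) (cong suc) suc-injective)))
  G-total (suc p) {n} a a<n = begin
    k * k ^ p                          ≡⟨ ∑-const k (k ^ p) ⟨
    ∑ k (λ j → k ^ p)                  ≤⟨ ∑-mono k (λ { j (s≤s j≤d) → G-total p (a + j) (bound j≤d) }) ⟩
    ∑ k (λ j → ∑ n (G p (a + j)))      ≡⟨ ∑-swap k n (λ j c → G p (a + j) c) ⟩
    ∑ n (G (suc p) a)                  ∎
    where
    bound : ∀ {j} → j ≤ d → a + j + p * d < n
    bound {j} j≤d = ≤-<-trans
      (subst (a + j + p * d ≤_) (+-assoc a d (p * d)) (+-monoˡ-≤ (p * d) (+-monoʳ-≤ a j≤d))) a<n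

  -- Log-concavity and the bound by two levels of the doubled grid.

  L : ℕ → ℕ → ℕ
  L p = G p 0

  -- By translation invariance this is the minor of `G p` with rows `0`, `x` and columns `x + m`,
  -- `x + (m + y)`.
  L-log-concave : ∀ p m x y → L p m * L p (m + (x + y)) ≤ L p (m + x) * L p (m + y)
  L-log-concave p m x y = begin
    L p m * L p (m + (x + y))
      ≡⟨ *-comm (L p m) _ ⟩
    L p (m + (x + y)) * L p m
      ≡⟨ cong₂ (λ s g → L p s * g) (regroup m x y) (sym (shift m)) ⟩
    G p 0 (x + (m + y)) * G p x (x + m)
      ≤⟨ G-TP2 p z≤n (+-monoʳ-≤ x (m≤m+n m y)) ⟩
    G p 0 (x + m) * G p x (x + (m + y))
      ≡⟨ cong₂ (λ s g → L p s * g) (+-comm x m) (shift (m + y)) ⟩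
    L p (m + x) * L p (m + y) ∎
    where
    shift : ∀ s → G p x (x + s) ≡ L p s
    shift s = trans (cong (λ a → G p a (x + s)) (sym (+-identityʳ x))) (G-translate p x 0 s)
    regroup : ∀ m x y → m + (x + y) ≡ x + (m + y)
    regroup = solve-∀

  balanced : ℕ → ℕ → ℕ
  balanced p s = L p ⌊ s /2⌋ * L p ⌈ s /2⌉

  L*L≤balanced-ordered : ∀ p m e → L p m * L p (m + e) ≤ balanced p (m + (m + e))
  L*L≤balanced-ordered p m e = begin
    L p m * L p (m + e)
      ≡⟨ cong (λ e → L p m * L p (m + e)) (⌊n/2⌋+⌈n/2⌉≡n e) ⟨
    L p m * L p (m + (⌊ e /2⌋ + ⌈ e /2⌉))
      ≤⟨ L-log-concave p m ⌊ e /2⌋ ⌈ e /2⌉ ⟩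
    L p (m + ⌊ e /2⌋) * L p (m + ⌈ e /2⌉)
      ≡⟨ cong₂ (λ a b → L p a * L p b) (halve m e) (trans (cong ⌊_/2⌋ shift) (halve m (suc e))) ⟨
    balanced p (m + (m + e)) ∎
    where
    halve : ∀ m e → ⌊ m + (m + e) /2⌋ ≡ m + ⌊ e /2⌋
    halve zero    e = refl
    halve (suc m) e = trans (cong (λ s → ⌊ suc s /2⌋) (+-suc m (m + e))) (cong suc (halve m e))
    shift : suc (m + (m + e)) ≡ m + (m + suc e)
    shift = sym (trans (cong (m +_) (+-suc m e)) (+-suc m (m + e)))

  L*L≤balanced : ∀ p m t → L p m * L p t ≤ balanced p (m + t)
  L*L≤balanced p m t with ≤-total m t
  ... | inj₁ m≤t = subst (λ t → L p m * L p t ≤ balanced p (m + t)) (m+[n∸m]≡n m≤t)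
                     (L*L≤balanced-ordered p m (t ∸ m))
  ... | inj₂ t≤m = subst₂ _≤_ (*-comm (L p t) _) (cong (balanced p) (+-comm t m))
                     (subst (λ m → L p t * L p m ≤ balanced p (t + m)) (m+[n∸m]≡n t≤m)
                       (L*L≤balanced-ordered p t (m ∸ t)))

  L*total≤levels : ∀ p m → L p m * k ^ p ≤ L (p + p) (p * d) + L (p + p) (suc (p * d))
  L*total≤levels p m = begin
    L p m * k ^ p
      ≤⟨ *-monoʳ-≤ (L p m) (G-total p 0 (n<1+n (p * d))) ⟩
    L p m * ∑ M (L p)
      ≡⟨ ∑-*ˡ M (L p m) (L p) ⟩
    ∑ M (λ t → L p m * L p t)
      ≤⟨ ∑-mono M (λ t _ → L*L≤balanced p m t) ⟩
    ∑ M (λ t → balanced p (m + t))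
      -- The missing terms `s < m` are added so that the shifted sum becomes one over an initial
      -- segment.
      ≤⟨ m≤n+m _ (∑ m (balanced p)) ⟩
    ∑ m (balanced p) + ∑ M (λ t → balanced p (m + t))
      ≡⟨ ∑-split m M (balanced p) ⟨
    ∑ n (balanced p)
      -- The range is doubled so that the indices pair up as `b * 2` and `suc (b * 2)`.
      ≤⟨ ∑-mono-range (balanced p) (m≤m*n n 2) ⟩
    ∑ (n * 2) (balanced p)
      ≡⟨ ∑-pairs n (balanced p) ⟩
    ∑ n (λ b → balanced p (b * 2) + balanced p (suc (b * 2)))
      ≡⟨ ∑-cong n (λ b _ → cong₂ _+_
           (cong₂ (λ x y → L p x * L p y) (⌊n*2/2⌋ b) (⌈n*2/2⌉ b))
           (cong₂ (λ x y → L p x * L p y) (⌈n*2/2⌉ b) (cong suc (⌊n*2/2⌋ b)))) ⟩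
    ∑ n (λ b → L p b * L p b + L p b * L p (suc b))
      ≡⟨ ∑-+ n (λ b → L p b * L p b) (λ b → L p b * L p (suc b)) ⟩
    ∑ n (λ b → L p b * L p b) + ∑ n (λ b → L p b * L p (suc b))
      ≤⟨ +-mono-≤ even odd ⟩
    L (p + p) N + L (p + p) (suc N) ∎
    where
    N = p * d
    M = suc N
    n = m + M

    ⌊n*2/2⌋ : ∀ b → ⌊ b * 2 /2⌋ ≡ b
    ⌊n*2/2⌋ zero    = refl
    ⌊n*2/2⌋ (suc b) = cong suc (⌊n*2/2⌋ b)

    ⌈n*2/2⌉ : ∀ b → ⌈ b * 2 /2⌉ ≡ b
    ⌈n*2/2⌉ zero    = refl
    ⌈n*2/2⌉ (suc b) = cong suc (⌈n*2/2⌉ b)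

    ∑-pairs : ∀ n h → ∑ (n * 2) h ≡ ∑ n (λ b → h (b * 2) + h (suc (b * 2)))
    ∑-pairs zero    h = refl
    ∑-pairs (suc n) h = trans (sym (+-assoc (h 0) (h 1) _))
      (cong (h 0 + h 1 +_) (∑-pairs n (λ s → h (suc (suc s)))))

    -- Symmetry replaces one factor by `G p b N`, which makes the sum of squares a convolution.
    even : ∑ n (λ b → L p b * L p b) ≤ L (p + p) N
    even = begin
      ∑ n (λ b → L p b * L p b)   ≡⟨ ∑-cong n (λ b _ → cong (L p b *_) (G-symmetric p 0 b)) ⟩
      ∑ n (λ b → L p b * G p b N) ≤⟨ G-compose p p n 0 N ⟩
      L (p + p) N                 ∎

    odd : ∑ n (λ b → L p b * L p (suc b)) ≤ L (p + p) (suc N)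
    odd = begin
      ∑ n (λ b → L p b * L p (suc b))
        ≡⟨ ∑-cong n (λ b _ → trans (*-comm (L p b) (L p (suc b))) (cong (L p (suc b) *_)
             (trans (sym (G-translate p 1 0 b)) (G-symmetric p 1 (suc b))))) ⟩
      ∑ n (λ b → L p (suc b) * G p (suc b) (suc N))
        -- Adds the term `b = 0`, which the shift by `suc` leaves out.
        ≤⟨ m≤n+m _ _ ⟩
      ∑ (suc n) (λ b → L p b * G p b (suc N))
        ≤⟨ G-compose p p (suc n) 0 (suc N) ⟩
      L (p + p) (suc N) ∎

  -- For j < c the windows starting at j and at c′ + j together cover the one starting at c.
  window-cover : ∀ φ {c c′} → c ≤ c′ → c′ + c ≡ k →
    c * ∑ k (λ i → φ (c + i)) ≤ ∑ k (λ j → ∑ k (λ i → φ (j + i)))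
  window-cover φ {c} {c′} c≤c′ c′+c≡k = begin
    c * A c
      ≡⟨ ∑-const c (A c) ⟨
    ∑ c (λ _ → A c)
      ≤⟨ ∑-mono c cover ⟩
    ∑ c (λ j → A j + A (c′ + j))
      ≡⟨ ∑-+ c A (λ j → A (c′ + j)) ⟩
    ∑ c A + ∑ c (λ j → A (c′ + j))
      ≤⟨ +-monoˡ-≤ _ (∑-mono-range A c≤c′) ⟩
    ∑ c′ A + ∑ c (λ j → A (c′ + j))
      ≡⟨ ∑-split c′ c A ⟨
    ∑ (c′ + c) A
      ≡⟨ cong (λ n → ∑ n A) c′+c≡k ⟩
    ∑ k A ∎
    where
    A : ℕ → ℕ
    A j = ∑ k (λ i → φ (j + i))

    c′≤k : c′ ≤ k
    c′≤k = subst (c′ ≤_) c′+c≡k (m≤m+n c′ c)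

    cover : ∀ j → j < c → A c ≤ A j + A (c′ + j)
    cover j j<c = begin
      A c
        ≡⟨ window c φ (+-monoˡ-≤ k (≤-trans c≤c′ c′≤k)) ⟩
      ∑ (k + k) (λ b → 𝟙 (inWindow? c b) * φ b)
        ≤⟨ ∑-mono (k + k) (λ b _ → *-monoˡ-≤ (φ b)
             (𝟙≤𝟙+𝟙 (inWindow? c b) (inWindow? j b) (inWindow? (c′ + j) b) split)) ⟩
      ∑ (k + k) (λ b → (𝟙 (inWindow? j b) + 𝟙 (inWindow? (c′ + j) b)) * φ b)
        ≡⟨ ∑-cong (k + k) (λ b _ → *-distribʳ-+ (φ b) (𝟙 (inWindow? j b)) (𝟙 (inWindow? (c′ + j) b))) ⟩
      ∑ (k + k) (λ b → 𝟙 (inWindow? j b) * φ b + 𝟙 (inWindow? (c′ + j) b) * φ b)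
        ≡⟨ ∑-+ (k + k) (λ b → 𝟙 (inWindow? j b) * φ b) (λ b → 𝟙 (inWindow? (c′ + j) b) * φ b) ⟩
      ∑ (k + k) (λ b → 𝟙 (inWindow? j b) * φ b) + ∑ (k + k) (λ b → 𝟙 (inWindow? (c′ + j) b) * φ b)
        ≡⟨ cong₂ _+_ (window j φ (+-monoˡ-≤ k (≤-trans j≤c (≤-trans c≤c′ c′≤k))))
                     (window (c′ + j) φ (+-monoˡ-≤ k c′+j≤k)) ⟨
      A j + A (c′ + j) ∎
      where
      j≤c = <⇒≤ j<c

      c′+j≤k : c′ + j ≤ k
      c′+j≤k = subst (c′ + j ≤_) c′+c≡k (+-monoʳ-≤ c′ j≤c)

      split : ∀ {b} → c ≤ b × b < c + k → (j ≤ b × b < j + k) ⊎ (c′ + j ≤ b × b < c′ + j + k)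
      split {b} (c≤b , b<c+k) with b <? j + k
      -- A point of the window at `c` is past `j`; if it is not in the window at `j`, it is at least
      -- `j + k`, hence at least `c′ + j`.
      ... | yes b<j+k = inj₁ (≤-trans j≤c c≤b , b<j+k)
      ... | no  b≮j+k = inj₂
        ( ≤-trans (subst (_≤ j + k) (+-comm j c′) (+-monoʳ-≤ j c′≤k)) (≮⇒≥ b≮j+k)
        , <-≤-trans b<c+k (+-monoˡ-≤ k (≤-trans c≤c′ (m≤m+n c′ j))))

  -- The right-hand level is a sum over its first two coordinates, that is, over windows with every
  -- start `j < k`; the left-hand level, translated by `c`, is the single window at `c`.
  level-growth : 1 < k → ∀ n s → k * L (suc n) s ≤ 3 * L (suc (suc n)) (⌊ k /2⌋ + s)
  level-growth 1<k n s = begin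
    k * L (suc n) s
      ≤⟨ *-monoˡ-≤ (L (suc n) s) k≤3c ⟩
    3 * c * L (suc n) s
      ≡⟨ *-assoc 3 c _ ⟩
    3 * (c * L (suc n) s)
      ≡⟨ cong (λ x → 3 * (c * x)) (∑-cong k (λ i _ → G-translate n c i s)) ⟨
    3 * (c * ∑ k (λ i → G n (c + i) (c + s)))
      ≤⟨ *-monoʳ-≤ 3 (window-cover (λ a → G n a (c + s)) (⌊n/2⌋≤⌈n/2⌉ k)
           (trans (+-comm ⌈ k /2⌉ c) (⌊n/2⌋+⌈n/2⌉≡n k))) ⟩
    3 * L (suc (suc n)) (c + s) ∎
    where
    c = ⌊ k /2⌋

    ⌈n/2⌉≤1+⌊n/2⌋ : ∀ n → ⌈ n /2⌉ ≤ 1 + ⌊ n /2⌋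
    ⌈n/2⌉≤1+⌊n/2⌋ zero          = z≤n
    ⌈n/2⌉≤1+⌊n/2⌋ (suc zero)    = s≤s z≤n
    ⌈n/2⌉≤1+⌊n/2⌋ (suc (suc n)) = s≤s (⌈n/2⌉≤1+⌊n/2⌋ n)

    k≤3c : k ≤ 3 * c
    k≤3c = begin
      k              ≡⟨ ⌊n/2⌋+⌈n/2⌉≡n k ⟨
      c + ⌈ k /2⌉    ≤⟨ +-monoʳ-≤ c (⌈n/2⌉≤1+⌊n/2⌋ k) ⟩
      -- Here `1 < k` gives `1 ≤ c`; the factor 3 is attained at `k = 3`.
      c + (1 + c)    ≤⟨ +-monoʳ-≤ c (+-mono-≤ (⌊n/2⌋-mono 1<k) (m≤m+n c 0)) ⟩
      3 * c          ∎

-- Counting with duplicate-free lists.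

lookup-injective : ∀ {A : Set} {xs : List A} → Unique xs →
  ∀ {i j} → List.lookup xs i ≡ List.lookup xs j → i ≡ j
lookup-injective (x∉ ∷ u) {zero}  {zero}  eq = refl
lookup-injective (x∉ ∷ u) {zero}  {suc j} eq = contradiction eq (All.lookup x∉ (∈-lookup j))
lookup-injective (x∉ ∷ u) {suc i} {zero}  eq = contradiction (sym eq) (All.lookup x∉ (∈-lookup i))
lookup-injective (x∉ ∷ u) {suc i} {suc j} eq = cong suc (lookup-injective u eq)

-- The pigeonhole principle on list positions. Injectivity is asked only on members of `xs`, since
-- the encoding of a vee-free family is shown injective only on that family.
injectiveOn⇒length≤ : ∀ {A B : Set} {xs : List A} {ys : List B} (g : A → B) → Unique xs →
  (∀ x → g x ∈ ys) →
  (∀ {x y} → x ∈ xs → y ∈ xs → g x ≡ g y → x ≡ y) →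
  length xs ≤ length ys
injectiveOn⇒length≤ {B = B} {xs} g unique g∈ injective =
  injective⇒≤ {f = λ i → index (g∈ (List.lookup xs i))} λ {i} {j} eq →
    lookup-injective unique (injective (∈-lookup i) (∈-lookup j)
      (index-injective (setoid B) (g∈ (List.lookup xs i)) (g∈ (List.lookup xs j)) eq))

length-cartesianProductWith : ∀ {A B C : Set} (g : A → B → C) xs ys →
  length (cartesianProductWith g xs ys) ≡ length xs * length ys
length-cartesianProductWith g []       ys = refl
length-cartesianProductWith g (x ∷ xs) ys = trans (length-++ (map (g x) ys))
  (cong₂ _+_ (length-map (g x) ys) (length-cartesianProductWith g xs ys))

length-filter-[_] : ∀ {A : Set} {P : A → Set} (P? : ∀ a → Dec (P a)) x →
  length (filter P? (x ∷ [])) ≡ 𝟙 (P? x)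
length-filter-[ P? ] x with does (P? x)
... | true  = refl
... | false = refl

length-filter-map : ∀ {A B : Set} {P : B → Set} {Q : A → Set} (P? : ∀ b → Dec (P b)) (Q? : ∀ a → Dec (Q a)) (g : A → B) →
  (∀ a → P (g a) → Q a) → (∀ a → Q a → P (g a)) →
  ∀ xs → length (filter P? (map g xs)) ≡ length (filter Q? xs)
length-filter-map P? Q? g P⇒Q Q⇒P []       = refl
length-filter-map P? Q? g P⇒Q Q⇒P (x ∷ xs) with P? (g x) | Q? x
... | yes _ | yes _ = cong suc (length-filter-map P? Q? g P⇒Q Q⇒P xs)
... | no  _ | no  _ = length-filter-map P? Q? g P⇒Q Q⇒P xs
... | yes p | no ¬q = contradiction (P⇒Q x p) ¬q
... | no ¬p | yes q = contradiction (Q⇒P x q) ¬p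

length-filter-product : ∀ {n} {A B C : Set} {P : C → Set} (P? : ∀ c → Dec (P c)) (g : A → B → C)
  (h : Fin n → A) ys →
  length (filter P? (cartesianProductWith g (tabulate h) ys)) ≡
  sum {n} (λ i → length (filter P? (map (g (h i)) ys)))
length-filter-product {zero}  P? g h ys = refl
length-filter-product {suc n} P? g h ys = begin-equality
  length (filter P? (map (g (h zero)) ys List.++ rest))
    ≡⟨ cong length (filter-++ P? (map (g (h zero)) ys) rest) ⟩
  length (filter P? (map (g (h zero)) ys) List.++ filter P? rest)
    ≡⟨ length-++ (filter P? (map (g (h zero)) ys)) ⟩
  length (filter P? (map (g (h zero)) ys)) + length (filter P? rest)
    ≡⟨ cong (length (filter P? (map (g (h zero)) ys)) +_) (length-filter-product P? g (λ i → h (suc i)) ys) ⟩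
  sum {suc n} (λ i → length (filter P? (map (g (h i)) ys))) ∎
  where rest = cartesianProductWith g (tabulate (λ i → h (suc i))) ys

-- Rank, order and joins in the grid.

rank : ∀ {k n} → Grid k n → ℕ
rank []      = 0
rank (j ∷ x) = toℕ j + rank x

≼-tail : ∀ {k n} {i j : Fin k} {x y : Grid k n} → (i ∷ x) ≼ (j ∷ y) → x ≼ y
≼-tail i∷x≼j∷y t = i∷x≼j∷y (suc t)

∷-mono-≼ : ∀ {k n} {i j : Fin k} {x y : Grid k n} → toℕ i ≤ toℕ j → x ≼ y → (i ∷ x) ≼ (j ∷ y)
∷-mono-≼ i≤j x≼y zero    = i≤j
∷-mono-≼ i≤j x≼y (suc t) = x≼y t

≼-refl : ∀ {k n} (x : Grid k n) → x ≼ x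
≼-refl x _ = ≤-refl

rank-mono : ∀ {k n} (x y : Grid k n) → x ≼ y → rank x ≤ rank y
rank-mono []      []      _   = z≤n
rank-mono (i ∷ x) (j ∷ y) x≼y = +-mono-≤ (x≼y zero) (rank-mono x y (≼-tail x≼y))

-- Strict monotonicity of rank: neither head nor tail can contribute a surplus, so both agree.
≼∧rank≥⇒≡ : ∀ {k n} (x y : Grid k n) → x ≼ y → rank y ≤ rank x → x ≡ y
≼∧rank≥⇒≡ []      []      _   _ = refl
≼∧rank≥⇒≡ (i ∷ x) (j ∷ y) x≼y r = cong₂ _∷_
  (toℕ-injective (≤-antisym (x≼y zero)
    (+-cancelʳ-≤ (rank y) _ _ (≤-trans r (+-monoʳ-≤ (toℕ i) (rank-mono x y (≼-tail x≼y)))))))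
  (≼∧rank≥⇒≡ x y (≼-tail x≼y)
    (+-cancelˡ-≤ (toℕ j) _ _ (≤-trans r (+-monoˡ-≤ (rank x) (x≼y zero)))))

maxF-≥ : ∀ {k} (a b : Fin k) → toℕ b ≤ toℕ a → maxF a b ≡ a
maxF-≥ a b b≤a with toℕ a ≤ᵇ toℕ b in eq
... | true  = toℕ-injective (≤-antisym b≤a (≤ᵇ⇒≤ (toℕ a) (toℕ b) (subst T (sym eq) _)))
... | false = refl

maxF-≤ : ∀ {k} (a b : Fin k) → toℕ a ≤ toℕ b → maxF a b ≡ b
maxF-≤ a b a≤b with toℕ a ≤ᵇ toℕ b in eq
... | true  = refl
... | false = contradiction (subst T eq (≤⇒≤ᵇ a≤b)) λ ()

∨-absorbˡ : ∀ {k n} (x y : Grid k n) → x ≼ y → x ∨ y ≡ y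
∨-absorbˡ []      []      _   = refl
∨-absorbˡ (i ∷ x) (j ∷ y) x≼y = cong₂ _∷_ (maxF-≤ i j (x≼y zero)) (∨-absorbˡ x y (≼-tail x≼y))

∨-absorbʳ : ∀ {k n} (x y : Grid k n) → y ≼ x → x ∨ y ≡ x
∨-absorbʳ []      []      _   = refl
∨-absorbʳ (i ∷ x) (j ∷ y) y≼x = cong₂ _∷_ (maxF-≥ i j (y≼x zero)) (∨-absorbʳ x y (≼-tail y≼x))

VeeFree⇒no-corner : ∀ {k e p q} {F : List (Grid k (e + (p + q)))} → VeeFree F →
  ∀ {z : Grid k e} {x x′ : Grid k p} {y y′ : Grid k q} →
  z ++ (x ++ y) ∈ F → z ++ (x′ ++ y) ∈ F → z ++ (x ++ y′) ∈ F →
  x′ ≼ x → x′ ≢ x → y′ ≼ y → y′ ≢ y → ⊥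
VeeFree⇒no-corner free {z} {x} {x′} {y} {y′} u∈ v∈ w∈ x′≼x x′≢x y′≼y y′≢y =
  free (z ++ (x ++ y) , z ++ (x′ ++ y) , z ++ (x ++ y′) , u∈ , v∈ , w∈ ,
    (λ eq → x′≢x (sym (xs≡ eq))) , (λ eq → y′≢y (sym (ys≡ eq))) , (λ eq → x′≢x (xs≡ eq)) ,
    sym (trans (zipWith-++ maxF z (x′ ++ y) z (x ++ y′))
      (cong₂ _++_ (∨-absorbˡ z z (≼-refl z)) (trans (zipWith-++ maxF x′ y x y′)
        (cong₂ _++_ (∨-absorbˡ x′ x x′≼x) (∨-absorbʳ y y′ y′≼y))))))
  where
  xs≡ : ∀ {a b} {c d} → z ++ (a ++ c) ≡ z ++ (b ++ d) → a ≡ b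
  xs≡ {a} {b} eq = ++-injectiveˡ a b (++-injectiveʳ z z eq)
  ys≡ : ∀ {a b} {c d} → z ++ (a ++ c) ≡ z ++ (b ++ d) → c ≡ d
  ys≡ {a} {b} eq = ++-injectiveʳ a b (++-injectiveʳ z z eq)

-- Enumeration of the grid and its levels.

grids : ∀ k n → List (Grid k n)
grids k zero    = [] ∷ []
grids k (suc n) = cartesianProductWith _∷_ (allFin k) (grids k n)

length-grids : ∀ k n → length (grids k n) ≡ k ^ n
length-grids k zero    = refl
length-grids k (suc n) = trans (length-cartesianProductWith _∷_ (allFin k) (grids k n))
  (cong₂ _*_ (length-tabulate {n = k} (λ i → i)) (length-grids k n))

∈-grids : ∀ {k n} (x : Grid k n) → x ∈ grids k n
∈-grids []      = here refl
∈-grids (j ∷ x) = ∈-cartesianProductWith⁺ _∷_ (∈-allFin j) (∈-grids x)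

grids-unique : ∀ k n → Unique (grids k n)
grids-unique k zero    = All.[] ∷ []
grids-unique k (suc n) = Unique.cartesianProductWith⁺ _∷_ ∷-injective (Unique.allFin⁺ k) (grids-unique k n)

level : ∀ k n → ℕ → List (Grid k n)
level k n c = filter (λ x → rank x ≟ c) (grids k n)

∈-level : ∀ {k n c} (x : Grid k n) → rank x ≡ c → x ∈ level k n c
∈-level x r = ∈-filter⁺ (λ x → rank x ≟ _) (∈-grids x) r

level-antichain : ∀ k n c → IsAntichain (level k n c)
level-antichain k n c = Unique.filter⁺ rank? (grids-unique k n) , λ x y x∈ y∈ x≼y →
  ≼∧rank≥⇒≡ x y x≼y (≤-reflexive (trans (rank≡ y∈) (sym (rank≡ x∈))))
  where
  rank? = λ (x : Grid k n) → rank x ≟ c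
  rank≡ : ∀ {x} → x ∈ level k n c → rank x ≡ c
  rank≡ x∈ = proj₂ (∈-filter⁻ rank? {xs = grids k n} x∈)

-- Level sizes and the symmetric chain decomposition.

module Chains (d : ℕ) where

  open Count d

  length-level : ∀ p c → length (level k p c) ≡ L p c
  length-level p c = count p 0
    where
    -- The offset `a` is generalised because each coordinate read is absorbed into it, as in the
    -- recursion for `G`.
    count : ∀ p a → length (filter (λ x → a + rank x ≟ c) (grids k p)) ≡ G p a c
    count zero a = trans (length-filter-[ (λ x → a + rank x ≟ c) ] [])
      (𝟙-cong (a + 0 ≟ c) (a ≟ c) (trans (sym (+-identityʳ a))) (trans (+-identityʳ a)))
    count (suc p) a = trans
      (length-filter-product (λ x → a + rank x ≟ c) _∷_ (λ (j : Fin k) → j) (grids k p))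
      (sum-cong-≗ {k} (λ j → trans
        (length-filter-map (λ x → a + rank x ≟ c) (λ x → a + toℕ j + rank x ≟ c) (j ∷_)
          (λ x → trans (+-assoc a (toℕ j) (rank x)))
          (λ x → trans (sym (+-assoc a (toℕ j) (rank x))))
          (grids k p))
        (count p (a + toℕ j))))

  L≤width : ∀ {n W} → IsWidth k n W → ∀ c → L n c ≤ W
  L≤width {n} (_ , maximal) c = subst (_≤ _) (length-level n c) (maximal _ (level-antichain k n c))

  -- A symmetric chain decomposition of [k]^p: the product of a chain with [k] splits
  -- into symmetric chains ("hooks"), the element j of [k] paired with position i of the
  -- chain lying on hook number i ⊓ (d ∸ j).  The hook numbers along the coordinates of x
  -- determine the chain of x; pos x is the position of x in it, bottom x the rank of its
  -- least element and top x the largest position in it.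
  hook : ∀ {p} → Fin k → Grid k p → ℕ
  pos  : ∀ {p} → Grid k p → ℕ

  hook j x = pos x ⊓ (d ∸ toℕ j)

  pos []      = 0
  pos (j ∷ x) = (pos x ∸ hook j x) + toℕ j

  data SameChain : ∀ {p} → Grid k p → Grid k p → Set where
    []  : SameChain [] []
    _∷_ : ∀ {p i j} {x y : Grid k p} → hook i x ≡ hook j y → SameChain x y → SameChain (i ∷ x) (j ∷ y)

  bottom : ∀ {p} → Grid k p → ℕ
  bottom []      = 0
  bottom (j ∷ x) = hook j x + bottom x

  top : ∀ {p} → Grid k p → ℕ
  top []      = 0
  top (j ∷ x) = (top x ∸ hook j x) + (d ∸ hook j x)

  SameChain-sym : ∀ {p} {x y : Grid k p} → SameChain x y → SameChain y x
  SameChain-sym []       = []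
  SameChain-sym (c ∷ cs) = sym c ∷ SameChain-sym cs

  SameChain-trans : ∀ {p} {x y z : Grid k p} → SameChain x y → SameChain y z → SameChain x z
  SameChain-trans []       []       = []
  SameChain-trans (c ∷ cs) (e ∷ es) = trans c e ∷ SameChain-trans cs es

  bottom-cong : ∀ {p} {x y : Grid k p} → SameChain x y → bottom x ≡ bottom y
  bottom-cong []       = refl
  bottom-cong (c ∷ cs) = cong₂ _+_ c (bottom-cong cs)

  hook≤pos : ∀ {p} j (x : Grid k p) → hook j x ≤ pos x
  hook≤pos j x = m⊓n≤m (pos x) _

  hook≤d : ∀ {p} j (x : Grid k p) → hook j x ≤ d
  hook≤d j x = ≤-trans (m⊓n≤n (pos x) _) (m∸n≤m d (toℕ j))

  toℕ≤d : (j : Fin k) → toℕ j ≤ d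
  toℕ≤d = toℕ≤pred[n]

  -- Chains skip no rank: a new coordinate merely transfers the hook number from the position to the
  -- bottom rank.
  rank≡pos+bottom : ∀ {p} (x : Grid k p) → rank x ≡ pos x + bottom x
  rank≡pos+bottom []      = refl
  rank≡pos+bottom (j ∷ x) = begin-equality
    toℕ j + rank x
      ≡⟨ cong (toℕ j +_) (rank≡pos+bottom x) ⟩
    toℕ j + (pos x + bottom x)
      ≡⟨ cong (λ q → toℕ j + (q + bottom x)) (sym (m∸n+n≡m (hook≤pos j x))) ⟩
    toℕ j + (pos x ∸ hook j x + hook j x + bottom x)
      ≡⟨ regroup (toℕ j) (pos x ∸ hook j x) (hook j x) (bottom x) ⟩
    pos x ∸ hook j x + toℕ j + (hook j x + bottom x) ∎
    where
    regroup : ∀ j q c b → j + (q + c + b) ≡ q + j + (c + b)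
    regroup = solve-∀

  pos≤top : ∀ {p} (x : Grid k p) → pos x ≤ top x
  pos≤top []      = z≤n
  pos≤top (j ∷ x) = +-mono-≤ (∸-monoˡ-≤ (hook j x) (pos≤top x))
    (subst (_≤ d ∸ hook j x) (m∸[m∸n]≡n (toℕ≤d j)) (∸-monoʳ-≤ d (m⊓n≤n (pos x) _)))

  hook≤top : ∀ {p} j (x : Grid k p) → hook j x ≤ top x
  hook≤top j x = ≤-trans (hook≤pos j x) (pos≤top x)

  -- Symmetry of the chains: the least rank `bottom x` and the greatest rank `bottom x + top x` add
  -- up to `p * d`.
  bottom+bottom+top : ∀ {p} (x : Grid k p) → bottom x + (bottom x + top x) ≡ p * d
  bottom+bottom+top []      = refl
  bottom+bottom+top {suc p} (j ∷ x) = begin-equality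
    c + bottom x + (c + bottom x + ((top x ∸ c) + (d ∸ c)))
      ≡⟨ regroup c (bottom x) (top x ∸ c) (d ∸ c) ⟩
    (d ∸ c + c) + (bottom x + (bottom x + (top x ∸ c + c)))
      ≡⟨ cong₂ (λ e t → e + (bottom x + (bottom x + t))) (m∸n+n≡m (hook≤d j x)) (m∸n+n≡m (hook≤top j x)) ⟩
    d + (bottom x + (bottom x + top x))
      ≡⟨ cong (d +_) (bottom+bottom+top x) ⟩
    d + p * d ∎
    where
    c = hook j x
    regroup : ∀ c b t e → c + b + (c + b + (t + e)) ≡ (e + c) + (b + (b + (t + c)))
    regroup = solve-∀

  -- Only `j < i` needs an argument. The common hook number is then below `d ∸ toℕ j`, so it equals
  -- `pos y` and is at most `pos x`; together with `x ≼ y` this forces `x ≡ y`.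
  ∷-comparable : ∀ {p i j} {x y : Grid k p} → SameChain (i ∷ x) (j ∷ y) → x ≼ y →
    (i ∷ x) ≼ (j ∷ y) ⊎ (j ∷ y) ≼ (i ∷ x)
  ∷-comparable {i = i} {j} {x} {y} (c ∷ cs) x≼y with toℕ i ≤? toℕ j
  ... | yes i≤j = inj₁ (∷-mono-≼ i≤j x≼y)
  ... | no  i≰j = inj₂ (∷-mono-≼ (<⇒≤ j<i) (subst (_≼ x) x≡y (≼-refl x)))
    where
    j<i = ≰⇒> i≰j

    hook<d∸j : hook j y < d ∸ toℕ j
    hook<d∸j = subst (_< d ∸ toℕ j) c (≤-<-trans (m⊓n≤n (pos x) _) (∸-monoʳ-< j<i (toℕ≤d i)))

    pos≤pos : pos y ≤ pos x
    pos≤pos with ⊓-sel (pos y) (d ∸ toℕ j)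
    ... | inj₁ ⊓≡pos = subst (_≤ pos x) (trans c ⊓≡pos) (hook≤pos i x)
    ... | inj₂ ⊓≡d∸j = contradiction ⊓≡d∸j (<⇒≢ hook<d∸j)

    x≡y : x ≡ y
    x≡y = ≼∧rank≥⇒≡ x y x≼y (subst₂ _≤_ (sym (rank≡pos+bottom y)) (sym (rank≡pos+bottom x))
      (+-mono-≤ pos≤pos (≤-reflexive (sym (bottom-cong cs)))))

  SameChain⇒comparable : ∀ {p} {x y : Grid k p} → SameChain x y → x ≼ y ⊎ y ≼ x
  SameChain⇒comparable []              = inj₁ λ ()
  SameChain⇒comparable x~y@(_ ∷ cs) with SameChain⇒comparable cs
  ... | inj₁ x≼y = ∷-comparable x~y x≼y
  ... | inj₂ y≼x with ∷-comparable (SameChain-sym x~y) y≼x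
  ...   | inj₁ ≼ = inj₂ ≼
  ...   | inj₂ ≽ = inj₁ ≽

  -- Hook number `c` has two arms. Up to position `d ∸ c` the tail stays at position `c` and the
  -- head grows; afterwards the head stays at `d ∸ c` and the tail climbs.
  onChain : ∀ {p} (x : Grid k p) q → q ≤ top x → Σ (Grid k p) λ y → SameChain x y × pos y ≡ q
  onChain []      zero _ = [] , [] , refl
  onChain (j ∷ x) q    q≤top with q ≤? d ∸ hook j x
  ... | yes q≤d∸c with onChain x (hook j x) (hook≤top j x)
  ...   | y , x~y , pos≡c = fromℕ< (s≤s q≤d) ∷ y , sym hook≡c ∷ x~y ,
            cong₂ _+_ (trans (cong₂ _∸_ pos≡c hook≡c) (n∸n≡0 c)) (toℕ-fromℕ< (s≤s q≤d))
    where
    c = hook j x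
    q≤d : q ≤ d
    q≤d = ≤-trans q≤d∸c (m∸n≤m d c)
    hook≡c : hook (fromℕ< (s≤s q≤d)) y ≡ c
    hook≡c = trans (cong₂ (λ a b → a ⊓ (d ∸ b)) pos≡c (toℕ-fromℕ< (s≤s q≤d)))
      (m≤n⇒m⊓n≡m (subst (_≤ d ∸ q) (m∸[m∸n]≡n (hook≤d j x)) (∸-monoʳ-≤ d q≤d∸c)))
  onChain (j ∷ x) q    q≤top | no q≰d∸c with onChain x (q ∸ (d ∸ hook j x) + hook j x) bound
    where
    bound : q ∸ (d ∸ hook j x) + hook j x ≤ top x
    bound = subst (q ∸ (d ∸ hook j x) + hook j x ≤_) (m∸n+n≡m (hook≤top j x))
      (+-monoˡ-≤ (hook j x) (m≤n+o⇒m∸n≤o q (d ∸ hook j x)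
        (subst (q ≤_) (+-comm (top x ∸ hook j x) _) q≤top)))
  ... | y , x~y , pos≡ = fromℕ< (s≤s (m∸n≤m d c)) ∷ y , sym hook≡c ∷ x~y ,
          trans (cong₂ _+_ (trans (cong₂ _∸_ pos≡ hook≡c) (m+n∸n≡m (q ∸ (d ∸ c)) c)) (toℕ-fromℕ< (s≤s (m∸n≤m d c))))
            (m∸n+n≡m (≰⇒≥ q≰d∸c))
    where
    c = hook j x
    hook≡c : hook (fromℕ< (s≤s (m∸n≤m d c))) y ≡ c
    hook≡c = trans (cong₂ (λ a b → a ⊓ (d ∸ b)) pos≡ (toℕ-fromℕ< (s≤s (m∸n≤m d c))))
      (trans (cong ((q ∸ (d ∸ c) + c) ⊓_) (m∸[m∸n]≡n (hook≤d j x)))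
        (m≥n⇒m⊓n≡n (m≤n+m c (q ∸ (d ∸ c)))))

  middle : ℕ → ℕ
  middle p = ⌊ p * d /2⌋

  -- Since `bottom x + (bottom x + top x)` is `p * d`, half of it lies between the least and the
  -- greatest rank of the chain.
  midpoint-exists : ∀ {p} (x : Grid k p) → Σ (Grid k p) λ y → SameChain x y × rank y ≡ middle p
  midpoint-exists {p} x = y , proj₁ (proj₂ on) , (begin-equality
    rank y                          ≡⟨ rank≡pos+bottom y ⟩
    pos y + bottom y                ≡⟨ cong₂ _+_ (proj₂ (proj₂ on)) (sym (bottom-cong (proj₁ (proj₂ on)))) ⟩
    middle p ∸ bottom x + bottom x  ≡⟨ m∸n+n≡m bottom≤middle ⟩
    middle p                        ∎)
    where
    b+t = bottom x + top x

    bottom≤middle : bottom x ≤ middle p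
    bottom≤middle = begin
      bottom x                   ≡⟨ n≡⌊n+n/2⌋ (bottom x) ⟩
      ⌊ bottom x + bottom x /2⌋  ≤⟨ ⌊n/2⌋-mono (+-monoʳ-≤ (bottom x) (m≤m+n (bottom x) (top x))) ⟩
      ⌊ bottom x + b+t /2⌋       ≡⟨ cong ⌊_/2⌋ (bottom+bottom+top x) ⟩
      middle p                   ∎

    middle≤b+t : middle p ≤ b+t
    middle≤b+t = begin
      middle p                   ≡⟨ cong ⌊_/2⌋ (bottom+bottom+top x) ⟨
      ⌊ bottom x + b+t /2⌋       ≤⟨ ⌊n/2⌋-mono (+-monoˡ-≤ b+t (m≤m+n (bottom x) (top x))) ⟩
      ⌊ b+t + b+t /2⌋            ≡⟨ n≡⌊n+n/2⌋ b+t ⟨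
      b+t                        ∎

    on = onChain x (middle p ∸ bottom x) (m≤n+o⇒m∸n≤o (middle p) (bottom x) middle≤b+t)
    y  = proj₁ on

  midpoint : ∀ {p} → Grid k p → Grid k p
  midpoint x = proj₁ (midpoint-exists x)

  midpoint∈level : ∀ {p} (x : Grid k p) → midpoint x ∈ level k p (middle p)
  midpoint∈level x = ∈-level (midpoint x) (proj₂ (proj₂ (midpoint-exists x)))

  -- The midpoint names the chain, so an antichain injects into the middle level; this is the form
  -- in which Sperner's theorem is used.
  midpoint≡⇒comparable : ∀ {p} (x y : Grid k p) → midpoint x ≡ midpoint y → x ≼ y ⊎ y ≼ x
  midpoint≡⇒comparable x y eq = SameChain⇒comparable (SameChain-trans
    (subst (SameChain x) eq (proj₁ (proj₂ (midpoint-exists x))))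
    (SameChain-sym (proj₁ (proj₂ (midpoint-exists y)))))

  -- Encoding a vee-free family by fibres and chains.

  module _ {e p} (F : List (Grid k (e + (p + p)))) (F-unique : Unique F) (free : VeeFree F) where

    zs : Grid k (e + (p + p)) → Grid k e
    zs u = take e u

    xs ys : Grid k (e + (p + p)) → Grid k p
    xs u = take p (drop e u)
    ys u = drop p (drop e u)

    parts : ∀ u → zs u ++ (xs u ++ ys u) ≡ u
    parts u = trans (cong (zs u ++_) (take++drop≡id p (drop e u))) (take++drop≡id e u)

    parts-injective : ∀ {u v} → zs u ≡ zs v → xs u ≡ xs v → ys u ≡ ys v → u ≡ v
    parts-injective {u} {v} z≡ x≡ y≡ =
      trans (sym (parts u)) (trans (cong₂ _++_ z≡ (cong₂ _++_ x≡ y≡)) (parts v))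

    IsBelow : Grid k (e + (p + p)) → Grid k (e + (p + p)) → Set
    IsBelow u v = zs v ≡ zs u × ys v ≡ ys u × xs v ≼ xs u × xs v ≢ xs u

    -- Failure of minimality within the x-fibre in `F`.
    Reducible : Grid k (e + (p + p)) → Set
    Reducible u = Any (IsBelow u) F

    reducible? : ∀ u → Dec (Reducible u)
    reducible? u = Any.any? (λ v → ≡-dec _≟F_ (zs v) (zs u) ×-dec ≡-dec _≟F_ (ys v) (ys u) ×-dec
      all? (λ i → lookup (xs v) i ≤F? lookup (xs u) i) ×-dec ¬? (≡-dec _≟F_ (xs v) (xs u))) F

    -- A witness of reducibility together with a strictly smaller `ys w` would form a corner at `u`.
    reducible⇒ys-minimal : ∀ {u w} → u ∈ F → w ∈ F → Reducible u →
      zs w ≡ zs u → xs w ≡ xs u → ys w ≼ ys u → w ≡ u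
    reducible⇒ys-minimal {u} {w} u∈ w∈ red z≡ x≡ y≼ with ≡-dec _≟F_ (ys w) (ys u) | find red
    ... | yes y≡ | _ = parts-injective z≡ x≡ y≡
    ... | no  y≢ | v , v∈ , zv≡ , yv≡ , xv≼ , xv≢ =
      ⊥-elim (VeeFree⇒no-corner {e = e} free {z = zs u}
        (subst (_∈ F) (sym (parts u)) u∈)
        (subst (_∈ F) (trans (sym (parts v)) (cong₂ (λ z y → z ++ (xs v ++ y)) zv≡ yv≡)) v∈)
        (subst (_∈ F) (trans (sym (parts w)) (cong₂ (λ z x → z ++ (x ++ ys w)) z≡ x≡)) w∈)
        xv≼ xv≢ y≼ y≢)

    irreducible⇒xs-minimal : ∀ {u w} → w ∈ F → ¬ Reducible u →
      zs w ≡ zs u → ys w ≡ ys u → xs w ≼ xs u → w ≡ u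
    irreducible⇒xs-minimal {u} {w} w∈ irr z≡ y≡ x≼ with ≡-dec _≟F_ (xs w) (xs u)
    ... | yes x≡ = parts-injective z≡ x≡ y≡
    ... | no  x≢ = contradiction (lose w∈ (z≡ , y≡ , x≼ , x≢)) irr

    -- Keeps the coordinates that fix the fibre in which `u` is minimal, and the chain of the
    -- remaining block. The decision is an argument so that injectivity can be proved by cases on
    -- it.
    key : ∀ u → Dec (Reducible u) → Bool × Grid k e × Grid k p × Grid k p
    key u (yes _) = true  , zs u , xs u , midpoint (ys u)
    key u (no  _) = false , zs u , ys u , midpoint (xs u)

    key-injective : ∀ {u v} → u ∈ F → v ∈ F → (u? : Dec (Reducible u)) (v? : Dec (Reducible v)) →
      key u u? ≡ key v v? → u ≡ v
    key-injective {u} {v} u∈ v∈ (yes ru) (yes rv) eq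
      with z≡ , eq′ ← ,-injective (,-injectiveʳ eq)
      with x≡ , m≡ ← ,-injective eq′
      with midpoint≡⇒comparable (ys u) (ys v) m≡
    ... | inj₁ u≼v = reducible⇒ys-minimal v∈ u∈ rv z≡ x≡ u≼v
    ... | inj₂ v≼u = sym (reducible⇒ys-minimal u∈ v∈ ru (sym z≡) (sym x≡) v≼u)
    key-injective {u} {v} u∈ v∈ (no iu)  (no iv)  eq
      with z≡ , eq′ ← ,-injective (,-injectiveʳ eq)
      with y≡ , m≡ ← ,-injective eq′
      with midpoint≡⇒comparable (xs u) (xs v) m≡
    ... | inj₁ u≼v = irreducible⇒xs-minimal u∈ iv z≡ y≡ u≼v
    ... | inj₂ v≼u = sym (irreducible⇒xs-minimal v∈ iu (sym z≡) (sym y≡) v≼u)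
    key-injective u∈ v∈ (yes _)  (no _)   ()
    key-injective u∈ v∈ (no _)   (yes _)  ()

    tags : List Bool
    tags = true ∷ false ∷ []

    codes : List (Grid k p × Grid k p)
    codes = cartesianProduct (grids k p) (level k p (middle p))

    keys : List (Bool × Grid k e × Grid k p × Grid k p)
    keys = cartesianProduct tags (cartesianProduct (grids k e) codes)

    key∈keys : ∀ u (u? : Dec (Reducible u)) → key u u? ∈ keys
    key∈keys u (yes _) = ∈-cartesianProduct⁺ {xs = tags} (here refl) (∈-cartesianProduct⁺ (∈-grids (zs u))
      (∈-cartesianProduct⁺ (∈-grids (xs u)) (midpoint∈level (ys u))))
    key∈keys u (no _)  = ∈-cartesianProduct⁺ {xs = tags} (there (here refl)) (∈-cartesianProduct⁺ (∈-grids (zs u))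
      (∈-cartesianProduct⁺ (∈-grids (ys u)) (midpoint∈level (xs u))))

    length-keys : length keys ≡ 2 * (k ^ e * (k ^ p * L p (middle p)))
    length-keys = begin-equality
      length keys
        ≡⟨ length-cartesianProductWith _,_ tags (cartesianProduct (grids k e) codes) ⟩
      2 * length (cartesianProduct (grids k e) codes)
        ≡⟨ cong (2 *_) (length-cartesianProductWith _,_ (grids k e) codes) ⟩
      2 * (length (grids k e) * length codes)
        ≡⟨ cong₂ (λ a b → 2 * (a * b)) (length-grids k e)
             (length-cartesianProductWith _,_ (grids k p) (level k p (middle p))) ⟩
      2 * (k ^ e * (length (grids k p) * length (level k p (middle p))))
        ≡⟨ cong₂ (λ a b → 2 * (k ^ e * (a * b))) (length-grids k p) (length-level p (middle p)) ⟩
      2 * (k ^ e * (k ^ p * L p (middle p))) ∎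

    VeeFree⇒length≤ : length F ≤ 2 * (k ^ e * (L (p + p) (p * d) + L (p + p) (suc (p * d))))
    VeeFree⇒length≤ = begin
      length F
        ≤⟨ injectiveOn⇒length≤ (λ u → key u (reducible? u)) F-unique (λ u → key∈keys u (reducible? u))
             (λ {u} {v} u∈ v∈ → key-injective u∈ v∈ (reducible? u) (reducible? v)) ⟩
      length keys
        ≡⟨ length-keys ⟩
      2 * (k ^ e * (k ^ p * L p (middle p)))
        ≡⟨ cong (λ x → 2 * (k ^ e * x)) (*-comm (k ^ p) _) ⟩
      2 * (k ^ e * (L p (middle p) * k ^ p))
        ≤⟨ *-monoʳ-≤ 2 (*-monoʳ-≤ (k ^ e) (L*total≤levels p (middle p))) ⟩
      2 * (k ^ e * (L (p + p) (p * d) + L (p + p) (suc (p * d)))) ∎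

-- Assembly according to the parity of the dimension.

even-or-odd : ∀ n → Σ ℕ λ p → n ≡ p + p ⊎ n ≡ 1 + (p + p)
even-or-odd zero    = 0 , inj₁ refl
even-or-odd (suc n) with even-or-odd n
... | p , inj₁ n≡ = p , inj₂ (cong suc n≡)
... | p , inj₂ n≡ = suc p , inj₁ (trans (cong suc n≡) (cong suc (sym (+-suc p p))))

theorem8 : Σ ℕ λ C → 0 < C ×
    (∀ (k n W : ℕ) → 1 < k → 1 < n → IsWidth k n W →
    ∀ (F : List (Grid k n)) → Unique F → VeeFree F → length F ≤ C * W)
-- The odd case sets the constant: 2 kinds of minimality, 2 levels, and 3 from `level-growth`. The
-- even case needs only 4.
theorem8 = 12 , s≤s z≤n , bound
  where
  bound : ∀ (k n W : ℕ) → 1 < k → 1 < n → IsWidth k n W →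
    ∀ (F : List (Grid k n)) → Unique F → VeeFree F → length F ≤ 12 * W
  bound (suc d) n W 1<k 1<n width F F-unique free with even-or-odd n
  ... | p , inj₁ refl = begin
    length F                     ≤⟨ VeeFree⇒length≤ {0} {p} F F-unique free ⟩
    2 * (1 * (L₀ + L₁))          ≤⟨ *-monoʳ-≤ 2 (*-monoʳ-≤ 1 (+-mono-≤ (L≤width width _) (L≤width width _))) ⟩
    2 * (1 * (W + W))            ≡⟨ collect W ⟩
    4 * W                        ≤⟨ *-monoˡ-≤ W (m≤m+n 4 8) ⟩
    12 * W                       ∎
    where
    open Count d
    open Chains d
    L₀ = L (p + p) (p * d)
    L₁ = L (p + p) (suc (p * d))
    collect : ∀ W → 2 * (1 * (W + W)) ≡ 4 * W
    collect = solve-∀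
  ... | zero , inj₂ refl = contradiction 1<n λ { (s≤s ()) }
  ... | p@(suc q) , inj₂ refl = begin
    length F
      ≤⟨ VeeFree⇒length≤ {1} {p} F F-unique free ⟩
    2 * (k ^ 1 * (L (p + p) N + L (p + p) (suc N)))
      ≡⟨ cong (λ x → 2 * (x * (L (p + p) N + L (p + p) (suc N)))) (*-identityʳ k) ⟩
    2 * (k * (L (p + p) N + L (p + p) (suc N)))
      ≡⟨ cong (2 *_) (*-distribˡ-+ k (L (p + p) N) _) ⟩
    2 * (k * L (p + p) N + k * L (p + p) (suc N))
      ≤⟨ *-monoʳ-≤ 2 (+-mono-≤ (scaled N) (scaled (suc N))) ⟩
    2 * (3 * W + 3 * W)
      ≡⟨ collect W ⟩
    12 * W ∎
    where
    open Count d
    open Chains d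
    N = p * d
    -- As `p` is `suc q`, `p + p` computes to `suc (q + p)`, the positive dimension that
    -- `level-growth` requires.
    scaled : ∀ s → k * L (p + p) s ≤ 3 * W
    scaled s = ≤-trans (level-growth 1<k (q + p) s) (*-monoʳ-≤ 3 (L≤width width _))
    collect : ∀ W → 2 * (3 * W + 3 * W) ≡ 12 * W
    collect = solve-∀
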